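{- There exist a finite set $V$ and a subsystem $\vec S$ of the bipartition universe $\vec U=\mathcal B(V)$ such that $\vec S$ is submodular in $\vec U$, but there are no submodular order function $f\colon\vec U\to\mathbb R_{\ge 0}$ and $k\in\mathbb R_{\ge 0}$ with $\vec S=\{s\in\vec U\mid f(s)<k\}$.
   Context: For a set $V$, the bipartition universe $\mathcal B(V)$ is the lattice of all subsets of $V$ ordered by inclusion (join is union, meet is intersection) with the order-reversing involution $A^*=V\setminus A$. A subsystem of $\mathcal B(V)$ is a subset closed under the involution. A subsystem $\vec S$ is submodular in $\vec U$ if for all $r,s\in\vec S$ at least one of $r\vee s$ and $r\wedge s$ (taken in $\vec U$) lies in $\vec S$. A submodular order function on $\vec U$ is a function $f\colon\vec U\to\mathbb R_{\ge 0}$ with $f(r\vee s)+f(r\wedge s)\le f(r)+f(s)$ for all $r,s\in\vec U$ and $f(s)=f(s^*)$ for all $s\in\vec U$. -}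

module Defs where

open import Level using (0ℓ)
open import Data.Nat using (ℕ)
open import Data.Rational using (ℚ; 0ℚ; ½; _+_; _-_; -_; _*_; _<_)
open import Data.Rational.Properties
open import Data.Rational.Solver using (module +-*-Solver)
open import Data.Fin.Subset using (Subset; _∪_; _∩_; ∁)
open import Data.Product using (∃-syntax; _×_; _,_)
open import Data.Sum using (_⊎_)
open import Data.Empty using (⊥-elim)
open import Relation.Nullary using (¬_)
open import Relation.Unary using (Pred; _⊆_; _∈_)
open import Relation.Binary.Definitions using (tri<; tri≈; tri>)
open import Relation.Binary.PropositionalEquality
  using (_≡_; refl; sym; trans; cong; subst)

-- Two-sided Dedekind cuts of ℚ.  `located` is arithmetical locatedness: the cut
-- contains rational bounds at arbitrarily small distance.  It is equivalent to
-- both sides being inhabited together with  p < q → lower p ⊎ upper q.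
record ℝ : Set₁ where
  field
    lower upper : Pred ℚ 0ℓ
    lower-down  : ∀ {p q} → p < q → lower q → lower p
    lower-open  : ∀ {p} → lower p → ∃[ q ] p < q × lower q
    upper-up    : ∀ {p q} → p < q → upper p → upper q
    upper-open  : ∀ {q} → upper q → ∃[ p ] p < q × upper p
    disjoint    : ∀ {q} → lower q → ¬ upper q
    located     : ∀ ε → 0ℚ < ε → ∃[ p ] ∃[ q ] lower p × upper q × q < p + ε

open ℝ public

infix 4 _≤ᴿ_ _<ᴿ_ _≃ᴿ_
infixl 6 _+ᴿ_

_≤ᴿ_ : ℝ → ℝ → Set
x ≤ᴿ y = lower x ⊆ lower y

_<ᴿ_ : ℝ → ℝ → Set
x <ᴿ y = ∃[ q ] upper x q × lower y q

-- Distinct cuts may have pointwise equivalent sides, so equality of reals is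
-- this equivalence relation rather than _≡_.
_≃ᴿ_ : ℝ → ℝ → Set
x ≃ᴿ y = x ≤ᴿ y × y ≤ᴿ x

lower<upper : ∀ x {p q} → lower x p → upper x q → p < q
lower<upper x {p} {q} l u with <-cmp p q
... | tri< p<q _ _    = p<q
... | tri≈ _ refl _   = ⊥-elim (disjoint x l u)
... | tri> _ _ q<p    = ⊥-elim (disjoint x l (upper-up x q<p u))

private
  open +-*-Solver

  q-b+b : ∀ q b → q ≡ (q - b) + b
  q-b+b = solve 2 (λ q b → q := (q :- b) :+ b) refl

  a+b-b : ∀ a b → (a + b) - b ≡ a
  a+b-b = solve 2 (λ a b → (a :+ b) :- b := a) refl

  interchange : ∀ a b c d → (a + c) + (b + d) ≡ (a + b) + (c + d)
  interchange = solve 4 (λ a b c d → (a :+ c) :+ (b :+ d) := (a :+ b) :+ (c :+ d)) refl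

  ½+½ : ∀ ε → ½ * ε + ½ * ε ≡ ε
  ½+½ ε = trans (sym (*-distribʳ-+ ε ½ ½)) (*-identityˡ ε)

  0<½* : ∀ {ε} → 0ℚ < ε → 0ℚ < ½ * ε
  0<½* {ε} 0<ε = subst (_< ½ * ε) (*-zeroʳ ½) (*-monoʳ-<-pos ½ 0<ε)

  <+⇒-< : ∀ {p a b} → p < a + b → p - b < a
  <+⇒-< {p} {a} {b} lt = subst (p - b <_) (a+b-b a b) (+-monoˡ-< (- b) lt)

  +<⇒<- : ∀ {q a b} → a + b < q → a < q - b
  +<⇒<- {q} {a} {b} lt = subst (_< q - b) (a+b-b a b) (+-monoˡ-< (- b) lt)

  located-0 : ∀ ε → 0ℚ < ε → ∃[ p ] ∃[ q ] p < 0ℚ × 0ℚ < q × q < p + ε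
  located-0 ε 0<ε =
    let p , -ε<p , p<0 = <-dense (neg-antimono-< 0<ε)
        q , 0<q , q<p+ε = <-dense (subst (_< p + ε) (+-inverseˡ ε) (+-monoˡ-< ε -ε<p))
    in p , q , p<0 , 0<q , q<p+ε

0ᴿ : ℝ
0ᴿ = record
  { lower      = _< 0ℚ
  ; upper      = 0ℚ <_
  ; lower-down = <-trans
  ; lower-open = λ p<0 → <-dense p<0
  ; upper-up   = λ p<q 0<p → <-trans 0<p p<q
  ; upper-open = λ 0<q → let p , 0<p , p<q = <-dense 0<q in p , p<q , 0<p
  ; disjoint   = λ q<0 0<q → <-asym q<0 0<q
  ; located    = located-0
  }

_+ᴿ_ : ℝ → ℝ → ℝ
x +ᴿ y = record
  { lower      = λ q → ∃[ a ] ∃[ b ] lower x a × lower y b × q ≡ a + b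
  ; upper      = λ q → ∃[ a ] ∃[ b ] upper x a × upper y b × q ≡ a + b
  ; lower-down = λ { {p} p<q (a , b , la , lb , refl) →
      p - b , b , lower-down x (<+⇒-< p<q) la , lb , q-b+b p b }
  ; lower-open = λ { (a , b , la , lb , refl) →
      let a′ , a<a′ , la′ = lower-open x la
      in a′ + b , +-monoˡ-< b a<a′ , a′ , b , la′ , lb , refl }
  ; upper-up   = λ { {_} {q} p<q (a , b , ua , ub , refl) →
      q - b , b , upper-up x (+<⇒<- p<q) ua , ub , q-b+b q b }
  ; upper-open = λ { (a , b , ua , ub , refl) →
      let a′ , a′<a , ua′ = upper-open x ua
      in a′ + b , +-monoˡ-< b a′<a , a′ , b , ua′ , ub , refl }
  ; disjoint   = λ { (a , b , la , lb , refl) (c , d , uc , ud , a+b≡c+d) →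
      <-irrefl a+b≡c+d (+-mono-< (lower<upper x la uc) (lower<upper y lb ud)) }
  ; located    = λ ε 0<ε →
      let a , c , la , uc , c<a+½ε = located x (½ * ε) (0<½* 0<ε)
          b , d , lb , ud , d<b+½ε = located y (½ * ε) (0<½* 0<ε)
      in a + b , c + d , (a , b , la , lb , refl) , (c , d , uc , ud , refl) ,
         subst (c + d <_)
           (trans (interchange a b (½ * ε) (½ * ε)) (cong ((a + b) +_) (½+½ ε)))
           (+-mono-< c<a+½ε d<b+½ε)
  }

-- Throughout, V is Fin n, so that the universe 𝓑(V) is Subset n with join _∪_,
-- meet _∩_ and involution ∁.
module _ {n : ℕ} where

  IsSubsystem : Pred (Subset n) 0ℓ → Set
  IsSubsystem S = ∀ {s} → s ∈ S → ∁ s ∈ S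

  IsSubmodular : Pred (Subset n) 0ℓ → Set
  IsSubmodular S = ∀ {r s} → r ∈ S → s ∈ S → (r ∪ s) ∈ S ⊎ (r ∩ s) ∈ S

  record IsSubmodularOrderFunction (f : Subset n → ℝ) : Set where
    field
      nonNegative : ∀ s → 0ᴿ ≤ᴿ f s
      submodular  : ∀ r s → f (r ∪ s) +ᴿ f (r ∩ s) ≤ᴿ f r +ᴿ f s
      symmetric   : ∀ s → f s ≃ᴿ f (∁ s)

{-# OPTIONS --safe #-}
module Submission where

-- Whenever f < k holds for r and s but fails for r ∪ s, submodularity makes
-- f (r ∩ s) strictly smaller than both f r and f s.  The system below, on six
-- points a, b, c, d, e, x, is submodular but omits a, e, x and their
-- complements; this gives, up to complementation, the cycle
-- f(ab) < f(abde) < f(de) < f(ab).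

open import Defs
open import Level using (0ℓ)
open import Data.Bool.Properties using () renaming (_≟_ to _≟ᵇ_)
open import Data.Fin using (#_)
open import Data.Fin.Subset using (Subset; ⊥; ∁; _∪_; _∩_; ⁅_⁆)
open import Data.List using (List; []; _∷_; _++_; map)
open import Data.List.Membership.Propositional using (_∈_)
open import Data.List.Relation.Unary.All using (all?; lookup)
open import Data.Nat using (ℕ)
open import Data.Product using (Σ-syntax; _×_; _,_; proj₁; proj₂)
open import Data.Rational using (0ℚ; _+_; _-_; -_; _<_)
open import Data.Rational.Properties
open import Data.Rational.Solver using (module +-*-Solver)
open import Data.Vec.Properties using (≡-dec)
open import Relation.Binary.PropositionalEquality
  using (_≡_; refl; sym; subst; subst₂)
open import Relation.Nullary using (¬_)
open import Relation.Nullary.Decidable using (from-yes; from-no; _⊎-dec_)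
open import Relation.Unary using (Pred; _≐_)

import Data.List.Membership.DecPropositional as DecMembership

<ᴿ-irrefl : ∀ x → ¬ (x <ᴿ x)
<ᴿ-irrefl x (_ , u , l) = disjoint x l u

<ᴿ-trans : ∀ x y z → x <ᴿ y → y <ᴿ z → x <ᴿ z
<ᴿ-trans x y z (p , ux , ly) (q , uy , lz) =
  p , ux , lower-down z (lower<upper y ly uy) lz

<ᴿ-≤ᴿ-trans : ∀ x y z → x <ᴿ y → y ≤ᴿ z → x <ᴿ z
<ᴿ-≤ᴿ-trans x y z (p , ux , ly) y≤z = p , ux , y≤z ly

private
  open +-*-Solver

  r+[q-p]+[p-q] : ∀ p q r → (r + (q - p)) + (p - q) ≡ r
  r+[q-p]+[p-q] = solve 3 (λ p q r → (r :+ (q :- p)) :+ (p :- q) := r) refl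

  q+[p-q] : ∀ p q → q + (p - q) ≡ p
  q+[p-q] = solve 2 (λ p q → q :+ (p :- q) := p) refl

  p+r-q : ∀ p q r → (p + r) - q ≡ r + (p - q)
  p+r-q = solve 3 (λ p q r → (p :+ r) :- q := r :+ (p :- q)) refl

  p+q-q : ∀ p q → (p + q) - q ≡ p
  p+q-q = solve 2 (λ p q → (p :+ q) :- q := p) refl

p<q⇒0<q-p : ∀ {p q} → p < q → 0ℚ < q - p
p<q⇒0<q-p {p} {q} p<q = subst (_< q - p) (+-inverseʳ p) (+-monoˡ-< (- p) p<q)

-- Locating `x` to within `q - p` gives bounds `s` and `t`. If `t < q`, then `t` would witness
-- `x <ᴿ k`; hence `q ≤ t`, which forces `p < s`.
≮⇒lower : ∀ x k {p q} → ¬ (x <ᴿ k) → lower k q → p < q → lower x p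
≮⇒lower x k {p} {q} x≮k lq p<q =
  let s , t , ls , ut , t<s+[q-p] = located x (q - p) (p<q⇒0<q-p p<q)
      q≤t = ≮⇒≥ (λ t<q → x≮k (t , ut , lower-down k t<q lq))
      p<s = subst₂ _<_ (q+[p-q] p q) (r+[q-p]+[p-q] p q s)
              (+-monoˡ-< (p - q) (≤-<-trans q≤t t<s+[q-p]))
  in lower-down x p<s ls

-- Classically w ≥ k > z, so x ≤ y + (z - w) < y. Constructively, a rational gap between `z` and `k`
-- sets the precision to which `x` is located.
+ᴿ-cancel-< : ∀ w x y z k → w +ᴿ x ≤ᴿ y +ᴿ z → z <ᴿ k → ¬ (w <ᴿ k) → x <ᴿ y
+ᴿ-cancel-< w x y z k w+x≤y+z (q , uq , lq) w≮k =
  -- `≮⇒lower` only reaches rationals strictly below a lower bound of `k`; passing to `q′` leaves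
  -- room for `p` above `q`.
  let q′ , q<q′ , lq′ = lower-open k lq
      p , q<p , p<q′ = <-dense q<q′
      s , t , ls , ut , t<s+[p-q] = located x (p - q) (p<q⇒0<q-p q<p)
      -- Here `n < q`, since `n` is below `z` and `q` above it. So `m` exceeds `s + (p - q)`, hence
      -- `t`, and `t` separates `x` from `y`.
      m , n , lm , ln , p+s≡m+n = w+x≤y+z (p , s , ≮⇒lower w k w≮k lq′ p<q′ , ls , refl)
      p+s<m+q = subst (_< m + q) (sym p+s≡m+n) (+-monoʳ-< m (lower<upper z ln uq))
      s+[p-q]<m = subst₂ _<_ (p+r-q p q s) (p+q-q m q) (+-monoˡ-< (- q) p+s<m+q)
  in t , ut , lower-down y (<-trans t<s+[p-q] s+[p-q]<m) lm

a b c d e ab de abc abe bde abde : Subset 6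
a = ⁅ # 0 ⁆
b = ⁅ # 1 ⁆
c = ⁅ # 2 ⁆
d = ⁅ # 3 ⁆
e = ⁅ # 4 ⁆
ab = a ∪ b
de = d ∪ e
abc = ab ∪ c
abe = ab ∪ e
bde = b ∪ de
abde = ab ∪ de

-- The sets `abc`, `bde` and `∁ abe` have as pairwise joins the complements of x, e and a, which are
-- omitted. Their pairwise meets `b`, `c` and `d` must therefore be present.
members : List (Subset 6)
members = half ++ map ∁ half
  where
  half : List (Subset 6)
  half = ⊥ ∷ b ∷ c ∷ d ∷ ab ∷ de ∷ abc ∷ abe ∷ bde ∷ abde ∷ []

open DecMembership (≡-dec {n = 6} _≟ᵇ_) using (_∈?_)

members-subsystem : IsSubsystem (_∈ members)
members-subsystem = lookup (from-yes (all? (λ s → ∁ s ∈? members) members))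

members-submodular : IsSubmodular (_∈ members)
members-submodular r∈ = lookup (lookup (from-yes
  (all? (λ r → all? (λ s → r ∪ s ∈? members ⊎-dec r ∩ s ∈? members) members) members)) r∈)

members-not-order-induced : (f : Subset 6 → ℝ) (k : ℝ) → IsSubmodularOrderFunction f →
  ¬ ((_∈ members) ≐ (λ s → f s <ᴿ k))
members-not-order-induced f k f-order (S⊆ , S⊇) = <ᴿ-irrefl (f ab)
  (<ᴿ-trans (f ab) (f (∁ abde)) (f ab) ab<∁abde
    (<ᴿ-trans (f (∁ abde)) (f de) (f ab) ∁abde<de de<ab))
  where
  open IsSubmodularOrderFunction f-order

  -- Here f(s) < k but not f(r ∪ s) < k, so cancellation puts f(r ∩ s) below f(r). Symmetry moves
  -- the bound to `∁ r`, so that instances can be chained.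
  ∩<∁ : ∀ r s → s ∈ members → ¬ (r ∪ s ∈ members) → f (r ∩ s) <ᴿ f (∁ r)
  ∩<∁ r s s∈S r∪s∉S = <ᴿ-≤ᴿ-trans (f (r ∩ s)) (f r) (f (∁ r))
    (+ᴿ-cancel-< (f (r ∪ s)) (f (r ∩ s)) (f r) (f s) k
      (submodular r s) (S⊆ s∈S) (λ r∪s<k → r∪s∉S (S⊇ r∪s<k)))
    (proj₁ (symmetric r))

  ab<∁abde : f ab <ᴿ f (∁ abde)
  -- The omitted join is the complement of x.
  ab<∁abde = ∩<∁ abde abc
    (from-yes (abc ∈? members)) (from-no (abde ∪ abc ∈? members))

  ∁abde<de : f (∁ abde) <ᴿ f de
  -- The omitted join is `∁ e`; the meet evaluates to `∁ abde`, and the double complement to `de`.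
  ∁abde<de = ∩<∁ (∁ de) (∁ abe)
    (from-yes (∁ abe ∈? members)) (from-no (∁ de ∪ ∁ abe ∈? members))

  de<ab : f de <ᴿ f ab
  -- The omitted join is `∁ a`.
  de<ab = ∩<∁ (∁ ab) bde
    (from-yes (bde ∈? members)) (from-no (∁ ab ∪ bde ∈? members))

theorem2 : Σ[ n ∈ ℕ ] Σ[ S ∈ Pred (Subset n) 0ℓ ]
    IsSubsystem S × IsSubmodular S ×
    ¬ (Σ[ f ∈ (Subset n → ℝ) ] Σ[ k ∈ ℝ ]
    IsSubmodularOrderFunction f × 0ᴿ ≤ᴿ k × S ≐ (λ s → f s <ᴿ k))
theorem2 = 6 , (_∈ members) , members-subsystem , members-submodular ,
  λ (f , k , f-order , _ , S≐) → members-not-order-induced f k f-order S≐
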